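{- Let $n\ge 1$. Every strict inclusion chain in the poset $\mathcal J_n$ has length at most $2$; that is, if $X_0\subsetneq X_1\subsetneq\cdots\subsetneq X_r$ with all $X_i\in\mathcal J_n$, then $r\le 2$. Equivalently, the order complex $\Delta(\mathcal J_n)$ satisfies $\dim\Delta(\mathcal J_n)\le 2$.
   Context: A partition of $n$ is a weakly decreasing sequence $\lambda=(\lambda_1\ge\cdots\ge\lambda_\ell>0)$ of positive integers with sum $n$, identified with its Ferrers diagram ($\lambda_i$ left-justified cells in row $i$); set $\lambda_{\ell+1}=0$. The partition graph $G_n$ has as vertices all partitions of $n$; two distinct partitions are adjacent if one is obtained from the other by removing one cell from a row, adding it to another row (possibly a new row of length $0$), and reordering the row lengths into weakly decreasing order. $K_n$ is the clique complex of $G_n$: its simplices are the finite nonempty cliques of $G_n$. A removable corner of $\lambda$ is the last cell of a row whose length is strictly greater than that of the next row; an addable corner is a position where a cell can be added so that the result is again a Ferrers diagram of a partition (row $\ell+1$ allowed). Write $r(\cdot)$ for the row number of a corner. For a removable corner $c$ and an addable corner $a$ of $\lambda$ with $r(c)\ne r(a)$, remove $c$ (decrease $\lambda_{r(c)}$ by $1$), add a cell at $a$ (increase $\lambda_{r(a)}$ by $1$), and reorder row lengths. If the result is a partition of $n$ different from $\lambda$, the transfer is called admissible and the result is denoted $\lambda(c\to a)$. The neighbors of $\lambda$ in $G_n$ are exactly the partitions $\lambda(c\to a)$ for admissible transfers. For a removable corner $c$ of $\lambda$, the full star-simplex is $\Sigma^{\mathrm{star}}_{\max}(\lambda,c):=\{\lambda\}\cup\{\lambda(c\to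 a):a \text{ with } \lambda(c\to a)\text{ admissible}\}$. For an addable corner $a$ of $\lambda$, the full top-simplex is $\Sigma^{\mathrm{top}}_{\max}(\lambda,a):=\{\lambda\}\cup\{\lambda(c\to a):c\text{ with }\lambda(c\to a)\text{ admissible}\}$. These are simplices of $K_n$. $\mathcal C_n$ is the set of all full star- and full top-simplices over all partitions $\lambda$ of $n$ and all their corners, with equal simplices identified. For each partition $\lambda$ of $n$, put $A_\lambda:=\{U\in\mathcal C_n:\lambda\in U\}$, and for each nonempty simplex $S$ of $K_n$ put $A_S:=\bigcap_{\lambda\in S}A_\lambda$. The poset $\mathcal J_n:=\{A_S: S\text{ a nonempty simplex of }K_n\}$ (equal intersections identified) is ordered by inclusion. The order complex $\Delta(P)$ of a poset $P$ is the simplicial complex of its finite nonempty chains. -}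

module Defs where

open import Data.Fin.Base using (Fin; suc; inject₁)
open import Data.List.Base using (List; []; length; filter; sum)
open import Data.List.Membership.Propositional using (_∈_)
open import Data.List.Relation.Binary.Permutation.Propositional using (_↭_)
open import Data.List.Relation.Unary.All as All using (All)
open import Data.List.Relation.Unary.AllPairs using (AllPairs)
open import Data.List.Relation.Unary.Linked as Linked using (Linked)
import Data.List.Relation.Unary.Unique.Setoid as UniqueSetoid
open import Data.Nat.Base using (ℕ; suc; pred; _≤_; _≥_; _<_)
open import Data.Nat.Properties using (_<?_; ≤-irrelevant; ≡-irrelevant)
open import Data.Product.Base using (_×_; _,_; proj₁; Σ-syntax; ∃-syntax)
open import Data.Sum.Base using (_⊎_)
open import Data.Vec.Base using (Vec; fromList; toList; lookup; updateAt; _∷ʳ_)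
open import Level as Level using (0ℓ; _⊔_)
open import Relation.Binary.Bundles using (Poset)
import Relation.Binary.Construct.On as On
open import Relation.Binary.PropositionalEquality using (_≡_; _≢_; refl)
open import Relation.Unary using (Pred; _≐_)
open import Relation.Unary.Relation.Binary.Subset using (⊆-poset)

private variable
  n : ℕ

record Partition (n : ℕ) : Set where
  constructor mkPartition
  field
    parts      : List ℕ
    decreasing : Linked _≥_ parts
    positive   : All (0 <_) parts
    total      : sum parts ≡ n

  ℓ : ℕ
  ℓ = length parts

open Partition public using (parts)

-- _≡_ on partitions is equality of the sequences of parts.
parts-injective : {p q : Partition n} → parts p ≡ parts q → p ≡ q
parts-injective {p = mkPartition _ d₁ p₁ t₁} {mkPartition _ d₂ p₂ t₂} refl
  with refl ← Linked.irrelevant ≤-irrelevant d₁ d₂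
     | refl ← All.irrelevant ≤-irrelevant p₁ p₂
     | refl ← ≡-irrelevant t₁ t₂ = refl

-- Row indices start at 0.  The last of the suc ℓ rows is the empty row below
-- the diagram.
Row : Partition n → Set
Row p = Fin (suc (Partition.ℓ p))

rows : (p : Partition n) → Vec ℕ (suc (Partition.ℓ p))
rows p = fromList (parts p) ∷ʳ 0

moveCell : (p : Partition n) → Row p → Row p → List ℕ
moveCell p i j = toList (updateAt (updateAt (rows p) i pred) j suc)

-- The parts of a partition are sorted, so at most one partition is a
-- reordering of xs; rows of length 0 are discarded.
_IsReorderingOf_ : Partition n → List ℕ → Set
q IsReorderingOf xs = parts q ↭ filter (0 <?_) xs

MovesTo : Partition n → Partition n → Set
MovesTo p q = Σ[ i ∈ Row p ] Σ[ j ∈ Row p ]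
  i ≢ j × 0 < lookup (rows p) i × q IsReorderingOf moveCell p i j

Adjacent : Partition n → Partition n → Set
Adjacent p q = p ≢ q × (MovesTo p q ⊎ MovesTo q p)

-- Simplicial complexes are given by their simplices, a simplex being listed as
-- a sequence of vertices without repetition; the order of the list is
-- immaterial.
DimAtMost : ∀ {a ℓ} {V : Set a} → Pred (List V) ℓ → ℕ → Set (a ⊔ ℓ)
DimAtMost Δ d = ∀ {xs} → Δ xs → length xs ≤ suc d

-- Adjacent vertices are distinct, so these lists have no repetition.
CliqueComplex : (n : ℕ) → Pred (List (Partition n)) 0ℓ
CliqueComplex n xs = xs ≢ [] × AllPairs Adjacent xs

OrderComplex : ∀ {c ℓ₁ ℓ₂} (P : Poset c ℓ₁ ℓ₂) →
               Pred (List (Poset.Carrier P)) (c ⊔ ℓ₁ ⊔ ℓ₂)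
OrderComplex P xs =
  xs ≢ [] × Unique xs × AllPairs (λ x y → x P.≤ y ⊎ y P.≤ x) xs
  where
  module P = Poset P
  open UniqueSetoid P.Eq.setoid using (Unique)

RemovableCorner : Partition n → Set
RemovableCorner p =
  Σ[ i ∈ Fin (Partition.ℓ p) ] lookup (rows p) (suc i) < lookup (rows p) (inject₁ i)

AddableCorner : Partition n → Set
AddableCorner p =
  Σ[ i ∈ Row p ] Linked _≥_ (toList (updateAt (rows p) i suc))

removableRow : (p : Partition n) → RemovableCorner p → Row p
removableRow p (i , _) = inject₁ i

addableRow : (p : Partition n) → AddableCorner p → Row p
addableRow p (i , _) = i

-- The transfer from c to a is admissible with result q.
Transfer : (p : Partition n) → RemovableCorner p → AddableCorner p →
           Pred (Partition n) 0ℓ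
Transfer p c a q =
  removableRow p c ≢ addableRow p a
  × q IsReorderingOf moveCell p (removableRow p c) (addableRow p a)
  × q ≢ p

fullStar : (p : Partition n) → RemovableCorner p → Pred (Partition n) 0ℓ
fullStar p c q = q ≡ p ⊎ ∃[ a ] Transfer p c a q

fullTop : (p : Partition n) → AddableCorner p → Pred (Partition n) 0ℓ
fullTop p a q = q ≡ p ⊎ ∃[ c ] Transfer p c a q

-- Sets of partitions are predicates, identified when extensionally equal.
PartitionSet : ℕ → Set₁
PartitionSet n = Pred (Partition n) 0ℓ

𝓒 : (n : ℕ) → Pred (PartitionSet n) 0ℓ
𝓒 n U = (∃[ p ] ∃[ c ] U ≐ fullStar {n} p c) ⊎ (∃[ p ] ∃[ a ] U ≐ fullTop {n} p a)

𝓐 : Partition n → Pred (PartitionSet n) 0ℓ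
𝓐 {n} p U = 𝓒 n U × U p

𝓐⟨_⟩ : List (Partition n) → Pred (PartitionSet n) 0ℓ
𝓐⟨ S ⟩ U = ∀ {p} → p ∈ S → 𝓐 p U

𝓙 : (n : ℕ) → Pred (Pred (PartitionSet n) 0ℓ) (Level.suc 0ℓ)
𝓙 n X = ∃[ S ] CliqueComplex n S × X ≐ 𝓐⟨ S ⟩

𝓙-poset : (n : ℕ) → Poset (Level.suc 0ℓ) (Level.suc 0ℓ) (Level.suc 0ℓ)
𝓙-poset n = On.poset (⊆-poset (PartitionSet n) 0ℓ) (proj₁ {B = 𝓙 n})

{-# OPTIONS --safe #-}

-- Encode a partition by its column lengths; moving a cell from column x to column y adds the root
-- δ y - δ x, and this is blind to the reordering of rows.  A full star consists of the partitions
-- h + δ y covering a fixed h, a full top of the partitions h - δ x covered by a fixed h, and two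
-- such families with three common members coincide.  Conversely, roots leading from one vertex of
-- a clique to the others pairwise share an endpoint, hence all share one, so every clique lies in
-- a full simplex.  In a chain X₀ ⊂ X₁ ⊂ X₂ ⊂ X₃ the strict inclusions above X₁ yield three distinct
-- partitions common to all members of X₁, so X₁ has at most one member; that member lies in X₀,
-- which is nonempty, contradicting X₀ ⊂ X₁.

module Submission where

open import Defs
open import Data.Fin.Base using (Fin; zero; suc; inject₁)
import Data.Fin.Properties as Fin
open import Data.List.Base using (List; []; _∷_; [_]; _++_; filter; length)
open import Data.List.Membership.DecPropositional using () renaming (_∈?_ to mem?)
open import Data.List.Membership.Propositional using (_∈_)
open import Data.List.Membership.Propositional.Properties using (∈-∃++; ∈-++⁺ˡ; ∈-++⁺ʳ)
open import Data.List.Properties using (≡-dec)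
open import Data.List.Relation.Binary.Equality.Propositional using (≋⇒≡)
open import Data.List.Relation.Binary.Permutation.Propositional
  using (_↭_; ↭-refl; ↭-sym; ↭-trans; prep; swap; ↭⇒↭ₛ)
  renaming (refl to ↭refl; trans to ↭trans)
open import Data.List.Relation.Binary.Permutation.Propositional.Properties
  using (∈-resp-↭; shift; drop-∷; ↭-length; ↭-empty-inv; All-resp-↭)
open import Data.List.Relation.Unary.All as All using (All; []; _∷_)
open import Data.List.Relation.Unary.All.Properties using (all-filter)
open import Data.List.Relation.Unary.AllPairs as AllPairs using (AllPairs; []; _∷_)
open import Data.List.Relation.Unary.Any using (here; there)
open import Data.List.Relation.Unary.Linked as Linked using (Linked; []; [-]; _∷_)
open import Data.List.Relation.Unary.Linked.Properties using (Linked⇒All)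
open import Data.List.Relation.Unary.Sorted.TotalOrder.Properties using (↗↭↗⇒≋)
open import Data.Nat.Base using (ℕ; zero; suc; pred; _+_; _≤_; _≥_; _<_; z≤n; s≤s; z<s)
open import Data.Nat.Properties
open import Data.Nat.Tactic.RingSolver using (solve-∀)
open import Data.Product.Base using (_×_; _,_; proj₁; proj₂; ∃-syntax; Σ-syntax)
open import Data.Sum.Base using (_⊎_; inj₁; inj₂)
open import Data.Vec.Base using (Vec; []; _∷_; toList; fromList; lookup; updateAt; _∷ʳ_)
open import Data.Vec.Membership.Propositional.Properties using (∈-lookup; ∈-toList⁺)
open import Data.Vec.Properties
  using (toList-∷ʳ; toList∘fromList; lookup∘updateAt; lookup∘updateAt′)
open import Function.Base using (_∘_)
open import Level using (0ℓ)
open import Relation.Binary.Core using (Rel)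
open import Relation.Binary.Definitions using (Transitive)
import Relation.Binary.Construct.Flip.EqAndOrd as Flip
open import Relation.Binary.PropositionalEquality hiding ([_])
open import Relation.Nullary using (Dec; yes; no; ¬_; contradiction)
open import Relation.Nullary.Decidable using (map′; _×-dec_; _⊎-dec_; ¬?; decidable-stable)
open import Relation.Unary using (Pred; _⊆_; _⊂_; _≐_)
open import Relation.Unary.Properties using (≐-refl; ≐-trans; ⊂-trans)

-- Unit vectors and coincidences among their sums.

δ : ℕ → ℕ → ℕ
δ zero    zero    = 1
δ zero    (suc _) = 0
δ (suc _) zero    = 0
δ (suc x) (suc k) = δ x k

δ-refl : ∀ x → δ x x ≡ 1
δ-refl zero    = refl
δ-refl (suc x) = δ-refl x

δ-pos : ∀ x k → 0 < δ x k → x ≡ k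
δ-pos zero    zero    _ = refl
δ-pos (suc x) (suc k) p = cong suc (δ-pos x k p)

δ-≢ : ∀ {x k} → x ≢ k → δ x k ≡ 0
δ-≢ {x} {k} x≢k with δ x k in eq
... | zero  = refl
... | suc _ = contradiction (δ-pos x k (subst (0 <_) (sym eq) z<s)) x≢k

pos-+ : ∀ m {n} → 0 < m + n → 0 < m ⊎ 0 < n
pos-+ zero    p = inj₂ p
pos-+ (suc m) _ = inj₁ z<s

-- Evaluation at `x`: the left side is positive there, so a summand on the right is. This reads sums
-- of `δ` as multisets of columns.
δ-≗-∈ : ∀ {x y} {f g : ℕ → ℕ} → (∀ k → δ x k + f k ≡ δ y k + g k) → x ≡ y ⊎ 0 < g x
δ-≗-∈ {x} {y} {f} eq
  with pos-+ (δ y x) (subst (0 <_) (eq x) (subst (λ d → 0 < d + f x) (sym (δ-refl x)) z<s))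
... | inj₁ p = inj₁ (sym (δ-pos y x p))
... | inj₂ p = inj₂ p

δ₂-∈ : ∀ x x′ y y′ → (∀ k → δ x k + δ x′ k ≡ δ y k + δ y′ k) → x ≡ y ⊎ x ≡ y′
δ₂-∈ x x′ y y′ eq with δ-≗-∈ {f = δ x′} {δ y′} eq
... | inj₁ p = inj₁ p
... | inj₂ p = inj₂ (sym (δ-pos y′ x p))

δ-injective : ∀ {x y} → (∀ k → δ x k ≡ δ y k) → x ≡ y
δ-injective {x} {y} eq = sym (δ-pos y x (subst (0 <_) (eq x) (subst (0 <_) (sym (δ-refl x)) z<s)))

-- Column lengths of lists of rows.

cell : ℕ → ℕ → ℕ
cell zero    _       = 0
cell (suc _) zero    = 1
cell (suc x) (suc k) = cell x k

cell-suc : ∀ x k → cell (suc x) k ≡ cell x k + δ x k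
cell-suc zero    zero    = refl
cell-suc zero    (suc k) = refl
cell-suc (suc x) zero    = refl
cell-suc (suc x) (suc k) = cell-suc x k

cell-split : ∀ x k → cell x k ≡ cell x (suc k) + δ x (suc k)
cell-split zero          k       = refl
cell-split (suc zero)    zero    = refl
cell-split (suc (suc x)) zero    = refl
cell-split (suc x)       (suc k) = cell-split x k

-- The length of column k (counted from 0) of the diagram with row lengths xs.  It is a complete invariant of the
-- multiset of positive row lengths, so no reordering is needed when a cell moves.
col : List ℕ → ℕ → ℕ
col []       k = 0
col (x ∷ xs) k = cell x k + col xs k

mult : List ℕ → ℕ → ℕ
mult []       k = 0
mult (x ∷ xs) k = δ x k + mult xs k

interchange : ∀ a b c d → (a + b) + (c + d) ≡ (a + c) + (b + d)
interchange = solve-∀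

swap-right : ∀ a b c → a + b + c ≡ a + c + b
swap-right = solve-∀

-- `cell x k` is the indicator of `k < x`, so a row counts in column `k` but not in column `suc k`
-- precisely when its length is `suc k`.
col-split : ∀ xs k → col xs k ≡ col xs (suc k) + mult xs (suc k)
col-split []       k = refl
col-split (x ∷ xs) k = trans (cong₂ _+_ (cell-split x k) (col-split xs k))
  (interchange (cell x (suc k)) (δ x (suc k)) (col xs (suc k)) (mult xs (suc k)))

col-suc-≤ : ∀ xs k → col xs (suc k) ≤ col xs k
col-suc-≤ xs k = subst (col xs (suc k) ≤_) (sym (col-split xs k)) (m≤m+n _ _)

mult-∈ : ∀ xs {k} → 0 < mult xs k → k ∈ xs
mult-∈ (x ∷ xs) {k} p with pos-+ (δ x k) p
... | inj₁ q = here (sym (δ-pos x k q))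
... | inj₂ q = there (mult-∈ xs q)

∈-mult : ∀ {xs k} → k ∈ xs → 0 < mult xs k
∈-mult {x ∷ xs} (here refl) = subst (λ d → 0 < d + mult xs x) (sym (δ-refl x)) z<s
∈-mult {x ∷ xs} {k} (there p) = ≤-trans (∈-mult p) (m≤n+m (mult xs k) (δ x k))

col-drop-∈ : ∀ xs {k} → col xs (suc k) < col xs k → suc k ∈ xs
col-drop-∈ xs {k} lt = mult-∈ xs (+-cancelˡ-< (col xs (suc k)) 0 _
  (subst₂ _<_ (sym (+-identityʳ _)) (col-split xs k) lt))

mult-cong : ∀ {xs ys} → (∀ k → col xs k ≡ col ys k) → ∀ k → mult xs (suc k) ≡ mult ys (suc k)
mult-cong {xs} {ys} eq k = +-cancelˡ-≡ (col xs (suc k)) _ _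
  (trans (sym (col-split xs k)) (trans (eq k) (trans (col-split ys k)
    (cong (_+ mult ys (suc k)) (sym (eq (suc k)))))))

col-↭ : ∀ {xs ys} → xs ↭ ys → ∀ k → col xs k ≡ col ys k
col-↭ ↭refl          k = refl
col-↭ (prep x p)     k = cong (cell x k +_) (col-↭ p k)
col-↭ (swap {xs = xs} {ys} x y p) k =
  trans (cong (λ c → cell x k + (cell y k + c)) (col-↭ p k))
  (rearrange (cell x k) (cell y k) (col ys k))
  where
  rearrange : ∀ a b c → a + (b + c) ≡ b + (a + c)
  rearrange = solve-∀
col-↭ (↭trans p q)   k = trans (col-↭ p k) (col-↭ q k)

col-filter : ∀ xs k → col (filter (0 <?_) xs) k ≡ col xs k
col-filter []           k = refl
col-filter (zero ∷ xs)  k = col-filter xs k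
col-filter (suc x ∷ xs) k = cong (cell (suc x) k +_) (col-filter xs k)

col-∷ʳ-0 : ∀ xs k → col (xs ++ [ 0 ]) k ≡ col xs k
col-∷ʳ-0 []       k = refl
col-∷ʳ-0 (x ∷ xs) k = cong (cell x k +_) (col-∷ʳ-0 xs k)

-- Differences of consecutive columns are multiplicities of positive lengths, so the head of `xs`
-- occurs in `ys` and can be deleted from both. Positivity enters because empty rows do not show in
-- the columns.
col-≗⇒↭ : ∀ {xs ys} → All (0 <_) xs → All (0 <_) ys → (∀ k → col xs k ≡ col ys k) → xs ↭ ys
col-≗⇒↭ {[]} {[]} _ _ _ = ↭-refl
col-≗⇒↭ {[]} {suc y ∷ ys} _ (_ ∷ _) eq = contradiction (eq 0) λ ()
col-≗⇒↭ {suc x ∷ xs} {ys} (_ ∷ xs>0) ys>0 eq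
  with as , bs , refl ← ∈-∃++ (mult-∈ ys (subst (0 <_) (mult-cong {suc x ∷ xs} {ys} eq x)
    (∈-mult {suc x ∷ xs} (here refl)))) =
  ↭-trans (prep (suc x) (col-≗⇒↭ xs>0 (All.tail (All-resp-↭ move ys>0)) eq′)) (↭-sym move)
  where
  move : as ++ suc x ∷ bs ↭ suc x ∷ as ++ bs
  move = shift (suc x) as bs
  eq′ : ∀ k → col xs k ≡ col (as ++ bs) k
  eq′ k = +-cancelˡ-≡ (cell (suc x) k) _ _ (trans (eq k) (col-↭ move k))

_↭?_ : (xs ys : List ℕ) → Dec (xs ↭ ys)
[]       ↭? []       = yes ↭-refl
[]       ↭? (y ∷ ys) = no λ p → contradiction (↭-empty-inv (↭-sym p)) λ ()
(x ∷ xs) ↭? ys with mem? _≟_ x ys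
... | no  x∉ys = no λ p → x∉ys (∈-resp-↭ p (here refl))
... | yes x∈ys with as , bs , refl ← ∈-∃++ x∈ys =
  map′ (λ p → ↭-trans (prep x p) (↭-sym (shift x as bs)))
       (λ p → drop-∷ (↭-trans p (shift x as bs)))
       (xs ↭? (as ++ bs))

-- Partitions through their columns.

private variable
  n : ℕ

column : Partition n → ℕ → ℕ
column p = col (parts p)

column-injective : {p q : Partition n} → (∀ k → column p k ≡ column q k) → p ≡ q
column-injective {p = p} {q} eq = parts-injective (≋⇒≡ (↗↭↗⇒≋ (Flip.totalOrder ≤-totalOrder)
  (Partition.decreasing p) (Partition.decreasing q)
  (↭⇒↭ₛ (col-≗⇒↭ (Partition.positive p) (Partition.positive q) eq))))

_≟ₚ_ : (p q : Partition n) → Dec (p ≡ q)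
p ≟ₚ q = map′ parts-injective (cong parts) (≡-dec _≟_ (parts p) (parts q))

col-updateAt-suc : ∀ {m} (v : Vec ℕ m) j k →
  col (toList (updateAt v j suc)) k ≡ col (toList v) k + δ (lookup v j) k
col-updateAt-suc (x ∷ v) zero k = trans (cong (_+ col (toList v) k) (cell-suc x k))
  (swap-right (cell x k) (δ x k) (col (toList v) k))
col-updateAt-suc (x ∷ v) (suc j) k = trans (cong (cell x k +_) (col-updateAt-suc v j k))
  (sym (+-assoc (cell x k) _ _))

col-updateAt-pred : ∀ {m} (v : Vec ℕ m) i {x} → lookup v i ≡ suc x → ∀ k →
  col (toList v) k ≡ col (toList (updateAt v i pred)) k + δ x k
col-updateAt-pred (_ ∷ v) zero {x} refl k = trans (cong (_+ col (toList v) k) (cell-suc x k))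
  (swap-right (cell x k) (δ x k) (col (toList v) k))
col-updateAt-pred (y ∷ v) (suc i) eq k = trans (cong (cell y k +_) (col-updateAt-pred v i eq k))
  (sym (+-assoc (cell y k) _ _))

toList-rows : (p : Partition n) → toList (rows p) ≡ parts p ++ [ 0 ]
toList-rows p = trans (toList-∷ʳ 0 (fromList (parts p))) (cong (_++ [ 0 ]) (toList∘fromList (parts p)))

col-rows : (p : Partition n) → ∀ k → col (toList (rows p)) k ≡ column p k
col-rows p k = trans (cong (λ xs → col xs k) (toList-rows p)) (col-∷ʳ-0 (parts p) k)

-- Corners in rows of prescribed length.

≥-trans : ∀ {x y z} → x ≥ y → y ≥ z → x ≥ z
≥-trans x≥y y≥z = ≤-trans y≥z x≥y

∷ʳ-0-decreasing : ∀ {xs} → Linked _≥_ xs → Linked _≥_ (xs ++ [ 0 ])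
∷ʳ-0-decreasing []        = [-]
∷ʳ-0-decreasing [-]       = z≤n ∷ [-]
∷ʳ-0-decreasing (p ∷ dec) = p ∷ ∷ʳ-0-decreasing dec

rows-decreasing : (p : Partition n) → Linked _≥_ (toList (rows p))
rows-decreasing p = subst (Linked _≥_) (sym (toList-rows p)) (∷ʳ-0-decreasing (Partition.decreasing p))

grow-head : ∀ {x xs} → Linked _≥_ (x ∷ xs) → Linked _≥_ (suc x ∷ xs)
grow-head [-]       = [-]
grow-head (p ∷ dec) = m≤n⇒m≤1+n p ∷ dec

-- The last row of length `suc x` is the corner, so the search continues in the tail as long as
-- `suc x` still occurs there.
removable-∃ : ∀ xs {x} → Linked _≥_ xs → suc x ∈ xs →
  let v = fromList xs ∷ʳ 0 in
  Σ[ i ∈ Fin (length xs) ] lookup v (suc i) < lookup v (inject₁ i) × lookup v (inject₁ i) ≡ suc x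
removable-∃ (y ∷ ys) {x} dec x∈ with mem? _≟_ (suc x) ys
... | yes x∈ys with i , lt , eq ← removable-∃ ys (Linked.tail dec) x∈ys = suc i , lt , eq
removable-∃ (_ ∷ ys) dec (there x∈) | no x∉ys = contradiction x∈ x∉ys
removable-∃ (_ ∷ []) dec (here refl) | no x∉ys = zero , z<s , refl
removable-∃ (_ ∷ z ∷ _) (p ∷ _) (here refl) | no x∉ys =
  zero , ≤∧≢⇒< p (λ eq → x∉ys (here (sym eq))) , refl

-- The first row of length `y` can grow.
addable-∃ : ∀ {m} (v : Vec ℕ m) {y} → Linked _≥_ (toList v) → y ∈ toList v →
  Σ[ j ∈ Fin m ] Linked _≥_ (toList (updateAt v j suc)) × lookup v j ≡ y
addable-∃ (z ∷ v) {y} dec y∈ with y ≟ z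
... | yes refl = zero , grow-head dec , refl
addable-∃ (z ∷ v) dec (here eq) | no y≢z = contradiction eq y≢z
addable-∃ (z ∷ v@(_ ∷ _)) (p ∷ dec) (there y∈) | no y≢z with addable-∃ v dec y∈
-- The growing row lies directly below `z`, so `z ≥ y` has to be strict; `y ≢ z` supplies this.
... | zero  , dec′ , refl = suc zero , ≤∧≢⇒< p y≢z ∷ dec′ , refl
... | suc j , dec′ , eq   = suc (suc j) , p ∷ dec′ , eq

-- A row that can both lose and gain a cell differs in length from all others.
corner-mult : ∀ {m} (v : Vec ℕ (suc m)) (i : Fin m) →
  Linked _≥_ (toList (updateAt v (inject₁ i) suc)) → lookup v (suc i) < lookup v (inject₁ i) →
  mult (toList v) (lookup v (inject₁ i)) ≡ 1
corner-mult (z ∷ v@(z′ ∷ _)) zero dec lt = cong₂ _+_ (δ-refl z) (n≤0⇒n≡0 (≮⇒≥ absurd))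
  where
  absurd : ¬ 0 < mult (toList v) z
  absurd p = <⇒≱ lt (All.lookup (Linked⇒All {R = _≥_} ≥-trans ≤-refl (Linked.tail dec))
    (mult-∈ (toList v) p))
corner-mult (z ∷ v@(_ ∷ _)) (suc i) dec lt = cong₂ _+_ (δ-≢ (λ eq → <⇒≢ w<z (sym eq)))
  (corner-mult v i (Linked.tail dec) lt)
  where
  v⁺ = updateAt v (inject₁ i) suc
  -- Even after growing, the row does not exceed `z`; before, it was strictly shorter.
  w<z : lookup v (inject₁ i) < z
  w<z = subst (_≤ z) (lookup∘updateAt (inject₁ i) v)
    (All.lookup (All.tail (Linked⇒All {R = _≥_} ≥-trans ≤-refl dec)) (∈-toList⁺ (∈-lookup (inject₁ i) v⁺)))

-- Moves of a cell between columns.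

record Step (x y : ℕ) (p q : Partition n) : Set where
  constructor step
  field
    distinct : x ≢ y
    -- Additive form of `q = p - δ x + δ y`. Columns count from 0, so the shrinking row has length
    -- `suc x` and the growing one length `y`.
    columns  : ∀ k → column q k + δ x k ≡ column p k + δ y k

Step-sym : ∀ {x y} {p q : Partition n} → Step x y p q → Step y x q p
Step-sym (step x≢y eq) = step (x≢y ∘ sym) (sym ∘ eq)

Step-source : ∀ {x y} {p q : Partition n} → Step x y p q → column p x ≡ suc (column q x)
Step-source {x = x} {y} {p} {q} (step x≢y eq) = begin
  column p x           ≡⟨ +-identityʳ _ ⟨
  column p x + 0       ≡⟨ cong (column p x +_) (δ-≢ (x≢y ∘ sym)) ⟨
  column p x + δ y x   ≡⟨ eq x ⟨
  column q x + δ x x   ≡⟨ cong (column q x +_) (δ-refl x) ⟩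
  column q x + 1       ≡⟨ +-comm _ 1 ⟩
  suc (column q x)     ∎
  where open ≡-Reasoning

Step-≤ : ∀ {x y} {p q : Partition n} → Step x y p q → ∀ {k} → k ≢ x → column p k ≤ column q k
Step-≤ {x = x} {y} {p} {q} (step _ eq) {k} k≢x = begin
  column p k          ≤⟨ m≤m+n _ _ ⟩
  column p k + δ y k  ≡⟨ eq k ⟨
  column q k + δ x k  ≡⟨ cong (column q k +_) (δ-≢ (k≢x ∘ sym)) ⟩
  column q k + 0      ≡⟨ +-identityʳ _ ⟩
  column q k          ∎
  where open ≤-Reasoning

-- Only in column `x` can `p` exceed `q`. As the columns of `q` decrease weakly, those of `p` drop
-- strictly after `x`, and a drop there is a row of length `suc x`.
Step-source-∈ : ∀ {x y} {p q : Partition n} → Step x y p q → suc x ∈ parts p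
Step-source-∈ {x = x} {p = p} {q} st = col-drop-∈ (parts p) (begin-strict
  column p (suc x)  ≤⟨ Step-≤ st (1+n≢n) ⟩
  column q (suc x)  ≤⟨ col-suc-≤ (parts q) x ⟩
  column q x        <⟨ n<1+n _ ⟩
  suc (column q x)  ≡⟨ Step-source st ⟨
  column p x        ∎)
  where open ≤-Reasoning

Step-target-∈ : ∀ {x y} {p q : Partition n} → Step x y p q → y ∈ toList (rows p)
Step-target-∈ {x = x} {y} {p} {q} st = subst (y ∈_) (sym (toList-rows p)) (target y st)
  where
  target : ∀ y → Step x y p q → y ∈ parts p ++ [ 0 ]
  -- A cell arriving in column 0 starts a new row: the appended empty row grows.
  target zero    _  = ∈-++⁺ʳ (parts p) (here refl)
  target (suc y) st = ∈-++⁺ˡ (col-drop-∈ (parts p) (begin-strict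
    column p (suc y)       <⟨ n<1+n _ ⟩
    suc (column p (suc y)) ≡⟨ Step-source (Step-sym st) ⟨
    column q (suc y)       ≤⟨ col-suc-≤ (parts q) y ⟩
    column q y             ≤⟨ Step-≤ (Step-sym st) (1+n≢n ∘ sym) ⟩
    column p y             ∎))
    where open ≤-Reasoning

-- From steps to admissible transfers.

col-moveCell : (p : Partition n) {i j : Row p} {x : ℕ} → i ≢ j → lookup (rows p) i ≡ suc x → ∀ k →
  col (moveCell p i j) k + δ x k ≡ column p k + δ (lookup (rows p) j) k
col-moveCell p {i} {j} {x} i≢j eq k = begin
  col (moveCell p i j) k + δ x k                 ≡⟨ cong (_+ δ x k) (col-updateAt-suc u j k) ⟩
  col (toList u) k + δ (lookup u j) k + δ x k    ≡⟨ swap-right (col (toList u) k) _ _ ⟩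
  col (toList u) k + δ x k + δ (lookup u j) k    ≡⟨ cong₂ _+_
    (trans (sym (col-updateAt-pred (rows p) i eq k)) (col-rows p k))
    (cong (λ y → δ y k) (lookup∘updateAt′ j i (i≢j ∘ sym) (rows p))) ⟩
  column p k + δ (lookup (rows p) j) k           ∎
  where
  open ≡-Reasoning
  u = updateAt (rows p) i pred

col-reordering : (q : Partition n) (xs : List ℕ) → q IsReorderingOf xs → ∀ k → column q k ≡ col xs k
col-reordering q xs q↭xs k = trans (col-↭ q↭xs k) (col-filter xs k)

-- A row that is both kinds of corner is the only row of its length `suc x`, so exactly one row ends
-- in column `x`.
corner-drop : (p : Partition n) {x : ℕ} (c : RemovableCorner p) (a : AddableCorner p) →
  lookup (rows p) (removableRow p c) ≡ suc x → removableRow p c ≡ addableRow p a →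
  column p x ≡ suc (column p (suc x))
corner-drop p {x} (i , lt) (_ , dec) eqx refl = begin
  column p x                                     ≡⟨ col-rows p x ⟨
  col rs x                                       ≡⟨ col-split rs x ⟩
  col rs (suc x) + mult rs (suc x)               ≡⟨ cong₂ _+_ (col-rows p (suc x))
    (trans (cong (mult rs) (sym eqx)) (corner-mult (rows p) i dec lt)) ⟩
  column p (suc x) + 1                           ≡⟨ +-comm _ 1 ⟩
  suc (column p (suc x))                         ∎
  where
  open ≡-Reasoning
  rs = toList (rows p)

Step⇒Transfer : ∀ {p q : Partition n} {x y} (c : RemovableCorner p) (a : AddableCorner p) →
  lookup (rows p) (removableRow p c) ≡ suc x → lookup (rows p) (addableRow p a) ≡ y →
  Step x y p q → Transfer p c a q
Step⇒Transfer {p = p} {q} {x} c a eqx refl st@(step x≢y eq) =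
  c≢a ,
  col-≗⇒↭ (Partition.positive q) (all-filter (0 <?_) (moveCell p _ _)) (λ k →
    +-cancelʳ-≡ (δ x k) _ _ (trans (eq k) (trans (sym (col-moveCell p c≢a eqx k))
      (cong (_+ δ x k) (sym (col-filter (moveCell p _ _) k)))))) ,
  λ { refl → x≢y (δ-injective λ k → +-cancelˡ-≡ (column p k) _ _ (eq k)) }
  where
  open ≤-Reasoning
  -- In a common row, `y` would be `suc x`, and by `corner-drop` the move would make column `suc x`
  -- of `q` longer than column `x`.
  c≢a : removableRow p c ≢ addableRow p a
  c≢a same = <-irrefl refl (begin-strict
    column p x                    ≡⟨ corner-drop p c a eqx same ⟩
    suc (column p (suc x))        <⟨ n<1+n _ ⟩
    suc (suc (column p (suc x)))  ≡⟨ cong suc (Step-source (Step-sym st′)) ⟨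
    suc (column q (suc x))        ≤⟨ s≤s (col-suc-≤ (parts q) x) ⟩
    suc (column q x)              ≡⟨ Step-source st ⟨
    column p x                    ∎)
    where
    st′ : Step x (suc x) p q
    st′ = subst (λ y → Step x y p q) (trans (cong (lookup (rows p)) (sym same)) eqx) st

removable-suc : (p : Partition n) (c : RemovableCorner p) →
  ∃[ x ] lookup (rows p) (removableRow p c) ≡ suc x
removable-suc p (i , lt) with suc x ← lookup (rows p) (inject₁ i) = x , refl

-- A removable corner in a row of length `suc x` serves every step out of column `x`; only the
-- addable corner depends on `y`. The lemma for tops is dual.
Step⇒fullStar : ∀ {p q : Partition n} {x y} (c : RemovableCorner p) →
  lookup (rows p) (removableRow p c) ≡ suc x → Step x y p q → fullStar p c q
Step⇒fullStar {p = p} c eqx st with j , dec , eqy ← addable-∃ (rows p) (rows-decreasing p) (Step-target-∈ st)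
  = inj₂ ((j , dec) , Step⇒Transfer c (j , dec) eqx eqy st)

Step⇒fullTop : ∀ {p q : Partition n} {x y} (a : AddableCorner p) →
  lookup (rows p) (addableRow p a) ≡ y → Step x y p q → fullTop p a q
Step⇒fullTop {p = p} a eqy st
  with i , lt , eqx ← removable-∃ (parts p) (Partition.decreasing p) (Step-source-∈ st)
  = inj₂ ((i , lt) , Step⇒Transfer (i , lt) a eqx eqy st)

-- Full simplices as families of covers.

Above : (ℕ → ℕ) → Pred (Partition n) 0ℓ
Above h q = ∃[ y ] ∀ k → column q k ≡ h k + δ y k

Below : (ℕ → ℕ) → Pred (Partition n) 0ℓ
Below h q = ∃[ x ] ∀ k → column q k + δ x k ≡ h k

-- The base is `p` with the corner cell deleted; taken as a mere function, it needs no proof of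
-- being a partition.
fullStar≐Above : (p : Partition n) (c : RemovableCorner p) →
  fullStar p c ≐ Above (col (toList (updateAt (rows p) (removableRow p c) pred)))
fullStar≐Above p c with x , eqx ← removable-suc p c = to , from
  where
  u = updateAt (rows p) (removableRow p c) pred
  col-p : ∀ k → column p k ≡ col (toList u) k + δ x k
  col-p k = trans (sym (col-rows p k)) (col-updateAt-pred (rows p) (removableRow p c) eqx k)
  to : fullStar p c ⊆ Above (col (toList u))
  to (inj₁ refl) = x , col-p
  to {q} (inj₂ ((j , _) , _ , q↭ , _)) = lookup u j , λ k →
    trans (col-reordering q (moveCell p _ _) q↭ k) (col-updateAt-suc u j k)
  from : Above (col (toList u)) ⊆ fullStar p c
  from {q} (y , eq) with x ≟ y
  -- Putting the cell back into column `x` restores `p` itself.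
  ... | yes refl = inj₁ (column-injective λ k → trans (eq k) (sym (col-p k)))
  ... | no  x≢y  = Step⇒fullStar c eqx (step x≢y λ k → trans (cong (_+ δ x k) (eq k))
    (trans (swap-right (col (toList u) k) _ _) (cong (_+ δ y k) (sym (col-p k)))))

fullTop≐Below : (p : Partition n) (a : AddableCorner p) →
  fullTop p a ≐ Below (col (toList (updateAt (rows p) (addableRow p a) suc)))
fullTop≐Below p a@(j , _) = to , from
  where
  u = updateAt (rows p) j suc
  y = lookup (rows p) j
  col-p : ∀ k → column p k + δ y k ≡ col (toList u) k
  col-p k = trans (cong (_+ δ y k) (sym (col-rows p k))) (sym (col-updateAt-suc (rows p) j k))
  to : fullTop p a ⊆ Below (col (toList u))
  to (inj₁ refl) = y , col-p
  to {q} (inj₂ (c , i≢j , q↭ , _)) with x , eqx ← removable-suc p c = x , λ k →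
    trans (cong (_+ δ x k) (col-reordering q (moveCell p _ _) q↭ k)) (trans (col-moveCell p i≢j eqx k) (col-p k))
  from : Below (col (toList u)) ⊆ fullTop p a
  from {q} (x , eq) with x ≟ y
  ... | yes refl = inj₁ (column-injective λ k → +-cancelʳ-≡ (δ y k) _ _ (trans (eq k) (sym (col-p k))))
  ... | no  x≢y  = Step⇒fullTop a refl (step x≢y λ k → trans (eq k) (sym (col-p k)))

-- Rigidity of full simplices.

𝓒-shape : ∀ {U} → 𝓒 n U → (∃[ h ] U ≐ Above h) ⊎ (∃[ h ] U ≐ Below h)
𝓒-shape (inj₁ (p , c , U≐)) = inj₁ (_ , ≐-trans U≐ (fullStar≐Above p c))
𝓒-shape (inj₂ (p , a , U≐)) = inj₂ (_ , ≐-trans U≐ (fullTop≐Below p a))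

-- Adding the equations puts `h + h′` on both sides; this replaces a subtraction of column
-- identities.
cancel-cross : ∀ h h′ {a b c d} → h + a ≡ h′ + c → h′ + b ≡ h + d → a + b ≡ c + d
cancel-cross h h′ {a} {b} {c} {d} eq₁ eq₂ = +-cancelˡ-≡ (h + h′) _ _ (begin
  h + h′ + (a + b)      ≡⟨ interchange h h′ a b ⟩
  (h + a) + (h′ + b)    ≡⟨ cong₂ _+_ eq₁ eq₂ ⟩
  (h′ + c) + (h + d)    ≡⟨ interchange h′ c h d ⟩
  h′ + h + (c + d)      ≡⟨ cong (_+ (c + d)) (+-comm h′ h) ⟩
  h + h′ + (c + d)      ∎)
  where open ≡-Reasoning

-- Eliminating the bases gives `δ y₁ + δ z₂ = δ z₁ + δ y₂`. Since `y₁ = y₂` would make `p` and `q`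
-- equal, `y₁ = z₁`, and the bases agree.
Above-unique : ∀ {h h′} {p q : Partition n} → p ≢ q →
  Above h p → Above h q → Above h′ p → Above h′ q → ∀ k → h k ≡ h′ k
Above-unique {h = h} {h′} p≢q (y₁ , p₁) (y₂ , q₁) (z₁ , p₂) (z₂ , q₂) k
  with δ₂-∈ y₁ z₂ z₁ y₂ (λ k → cancel-cross (h k) (h′ k) (trans (sym (p₁ k)) (p₂ k)) (trans (sym (q₂ k)) (q₁ k)))
... | inj₁ refl = +-cancelʳ-≡ (δ y₁ k) _ _ (trans (sym (p₁ k)) (p₂ k))
... | inj₂ refl = contradiction (column-injective λ k → trans (p₁ k) (sym (q₁ k))) p≢q

Below-unique : ∀ {h h′} {p q : Partition n} → p ≢ q →
  Below h p → Below h q → Below h′ p → Below h′ q → ∀ k → h k ≡ h′ k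
Below-unique {p = p} {q} p≢q (y₁ , p₁) (y₂ , q₁) (z₁ , p₂) (z₂ , q₂) k
  with δ₂-∈ y₁ z₂ y₂ z₁ (λ k → cancel-cross (column p k) (column q k)
    (trans (p₁ k) (sym (q₁ k))) (trans (q₂ k) (sym (p₂ k))))
... | inj₁ refl = contradiction (column-injective λ k →
  +-cancelʳ-≡ (δ y₁ k) _ _ (trans (p₁ k) (sym (q₁ k)))) p≢q
... | inj₂ refl = trans (sym (p₁ k)) (p₂ k)

-- Both `δ y + δ x` for `p` and that for `q` equal the difference of `h′` and `h`, and distinct
-- members use different `y`; so the two columns trade places.
Above∩Below-cross : ∀ {h h′} {p q : Partition n} → p ≢ q →
  ((y , _) : Above h p) → Below h′ p → Above h q → ((x , _) : Below h′ q) → y ≡ x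
Above∩Below-cross {h = h} p≢q (y₁ , p₁) (x₁ , p₂) (y₂ , q₁) (x₂ , q₂)
  with δ₂-∈ y₁ x₁ y₂ x₂ (λ k → +-cancelˡ-≡ (h k) _ _ (trans (sym (+-assoc (h k) _ _))
    (trans (cong (_+ δ x₁ k) (sym (p₁ k))) (trans (p₂ k) (trans (sym (q₂ k))
    (trans (cong (_+ δ x₂ k) (q₁ k)) (+-assoc (h k) _ _)))))))
... | inj₁ refl = contradiction (column-injective λ k → trans (p₁ k) (sym (q₁ k))) p≢q
... | inj₂ eq   = eq

-- The columns added to `h` for `p` and for `q` would both be the one that `r` lacks from `h′`.
Above∩Below-≤2 : ∀ {h h′} {p q r : Partition n} → p ≢ q → p ≢ r → q ≢ r →
  Above h p → Above h q → Above h r → Below h′ p → Below h′ q → ¬ Below h′ r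
Above∩Below-≤2 p≢q p≢r q≢r ap@(_ , p₁) aq@(_ , q₁) ar bp bq br
  with refl ← Above∩Below-cross p≢r ap bp ar br
  with refl ← Above∩Below-cross q≢r aq bq ar br
  = p≢q (column-injective λ k → trans (p₁ k) (sym (q₁ k)))

-- For two families of the same kind, two common members fix the base; the third excludes a star
-- paired with a top.
𝓒-rigid : ∀ {U V} {p q r : Partition n} → 𝓒 n U → 𝓒 n V → p ≢ q → p ≢ r → q ≢ r →
  U p → U q → U r → V p → V q → V r → U ⊆ V
𝓒-rigid 𝓒U 𝓒V p≢q p≢r q≢r Up Uq Ur Vp Vq Vr with 𝓒-shape 𝓒U | 𝓒-shape 𝓒V
... | inj₁ (_ , to , from) | inj₁ (_ , to′ , from′) = λ Us →
  let y , eq = to Us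
      h≗h′   = Above-unique p≢q (to Up) (to Uq) (to′ Vp) (to′ Vq)
  in from′ (y , λ k → trans (eq k) (cong (_+ δ y k) (h≗h′ k)))
... | inj₂ (_ , to , from) | inj₂ (_ , to′ , from′) = λ Us →
  let x , eq = to Us
  in from′ (x , λ k → trans (eq k) (Below-unique p≢q (to Up) (to Uq) (to′ Vp) (to′ Vq) k))
... | inj₁ (_ , to , _) | inj₂ (_ , to′ , _) =
  contradiction (to′ Vr) (Above∩Below-≤2 p≢q p≢r q≢r (to Up) (to Uq) (to Ur) (to′ Vp) (to′ Vq))
... | inj₂ (_ , to , _) | inj₁ (_ , to′ , _) =
  contradiction (to Ur) (Above∩Below-≤2 p≢q p≢r q≢r (to′ Vp) (to′ Vq) (to′ Vr) (to Up) (to Uq))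

-- Cliques lie in full simplices.

MovesTo⇒Step : {p q : Partition n} → p ≢ q → MovesTo p q → ∃[ x ] ∃[ y ] Step x y p q
MovesTo⇒Step {p = p} {q} p≢q (i , j , i≢j , 0<i , q↭) with lookup (rows p) i in eqx
... | suc x = x , lookup (rows p) j , step x≢y columns
  where
  columns : ∀ k → column q k + δ x k ≡ column p k + δ (lookup (rows p) j) k
  columns k = trans (cong (_+ δ x k) (col-reordering q (moveCell p _ _) q↭ k)) (col-moveCell p i≢j eqx k)
  x≢y : x ≢ lookup (rows p) j
  x≢y refl = p≢q (column-injective λ k → sym (+-cancelʳ-≡ (δ x k) _ _ (columns k)))

Adjacent⇒Step : {p q : Partition n} → Adjacent p q → ∃[ x ] ∃[ y ] Step x y p q
Adjacent⇒Step (p≢q , inj₁ m) = MovesTo⇒Step p≢q m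
Adjacent⇒Step (p≢q , inj₂ m) with x , y , st ← MovesTo⇒Step (p≢q ∘ sym) m = y , x , Step-sym st

-- The roots along `p`, `q`, `r` add up to the root from `p` to `r`; negative terms are moved
-- across.
Steps-balance : ∀ {x y x′ y′ i j} {p q r : Partition n} →
  Step x y p q → Step x′ y′ p r → Step i j q r →
  ∀ k → δ x k + (δ y′ k + δ i k) ≡ δ y k + (δ x′ k + δ j k)
Steps-balance {x = x} {y} {x′} {y′} {i} {j} {p} {q} {r} (step _ eq) (step _ eq′) (step _ eq″) k =
  +-cancelˡ-≡ (column q k + column p k + column r k) _ _
    (trans (gather (column q k) (column p k) (column r k) (δ x k) (δ y′ k) (δ i k))
    (trans (cong₂ _+_ (cong₂ _+_ (eq k) (sym (eq′ k))) (eq″ k))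
    (ungather (column q k) (column p k) (column r k) (δ y k) (δ x′ k) (δ j k))))
  where
  gather : ∀ q p r a b c → q + p + r + (a + (b + c)) ≡ ((q + a) + (p + b)) + (r + c)
  gather = solve-∀
  ungather : ∀ q p r a b c → ((p + a) + (r + b)) + (q + c) ≡ q + p + r + (a + (b + c))
  ungather = solve-∀

-- The difference of the roots δ y - δ x and δ y′ - δ x′ is again a root (or zero) only if they
-- share an endpoint.
Steps-share : ∀ {x y x′ y′} {p q r : Partition n} →
  Step x y p q → Step x′ y′ p r → Adjacent q r → x ≡ x′ ⊎ y ≡ y′
Steps-share {x = x} {y} {x′} {y′} st st′ adj
  with i , j , st″ ← Adjacent⇒Step adj
  with δ-≗-∈ {f = λ k → δ y′ k + δ i k} {λ k → δ x′ k + δ j k} (Steps-balance st st′ st″)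
... | inj₁ x≡y = contradiction x≡y (Step.distinct st)
... | inj₂ pos with pos-+ (δ x′ x) pos
...   | inj₁ p = inj₁ (sym (δ-pos x′ x p))
-- With `x = j` the balance loses `δ x` and becomes `δ y′ + δ i = δ y + δ x′`; as `y′ ≢ x′`, this
-- leaves `y′ = y`.
...   | inj₂ p with refl ← δ-pos j x p
      with δ₂-∈ y′ i y x′ (λ k → +-cancelˡ-≡ (δ x k) _ _ (trans (Steps-balance st st′ st″ k)
        (trans (sym (+-assoc (δ y k) _ _)) (+-comm _ (δ x k)))))
...     | inj₁ y′≡y  = inj₂ (sym y′≡y)
...     | inj₂ y′≡x′ = contradiction (sym y′≡x′) (Step.distinct st′)

Steps-common-end : ∀ {x y} {p q : Partition n} → Step x y p q → ∀ {rs} →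
  All (Adjacent p) rs → All (Adjacent q) rs → AllPairs Adjacent rs →
  All (λ r → ∃[ y′ ] Step x y′ p r) rs ⊎ All (λ r → ∃[ x′ ] Step x′ y p r) rs
Steps-common-end st [] [] [] = inj₁ []
Steps-common-end {x = x} {y} st (p~r ∷ p~rs) (q~r ∷ q~rs) (r~rs ∷ rs~)
  with x′ , y′ , st′ ← Adjacent⇒Step p~r
  with Steps-share st st′ q~r | Steps-common-end st p~rs q~rs rs~
... | inj₁ refl | inj₁ sources = inj₁ ((y′ , st′) ∷ sources)
... | inj₂ refl | inj₂ targets = inj₂ ((x′ , st′) ∷ targets)
... | inj₂ refl | inj₁ sources with x′ ≟ x
...   | yes refl = inj₁ ((y′ , st′) ∷ sources)
-- The step to `r` leaves a column other than `x`, so any step out of `x` can share only the target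
-- with it: all of them end in `y`.
...   | no  x′≢x = inj₂ ((x′ , st′) ∷ All.zipWith target (r~rs , sources))
  where
  target : ∀ {s} → Adjacent _ s × (∃[ y″ ] Step x y″ _ s) → ∃[ x″ ] Step x″ y _ s
  target (r~s , _ , st″) with Steps-share st′ st″ r~s
  ... | inj₁ x′≡x = contradiction x′≡x x′≢x
  ... | inj₂ refl = x , st″
Steps-common-end {x = x} {y} st (p~r ∷ p~rs) (q~r ∷ q~rs) (r~rs ∷ rs~)
    | inj₁ refl | inj₂ targets with y′ ≟ y
...   | yes refl = inj₂ ((x , st′) ∷ targets)
...   | no  y′≢y = inj₁ ((y′ , st′) ∷ All.zipWith source (r~rs , targets))
  where
  source : ∀ {s} → Adjacent _ s × (∃[ x″ ] Step x″ y _ s) → ∃[ y″ ] Step x y″ _ s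
  source (r~s , _ , st″) with Steps-share st′ st″ r~s
  ... | inj₁ refl = y , st″
  ... | inj₂ y′≡y = contradiction y′≡y y′≢y

-- Makes every element of `𝓙 n` nonempty.
clique⊆simplex : ∀ {S} → CliqueComplex n S → ∃[ U ] 𝓐⟨ S ⟩ U
clique⊆simplex {S = []} (S≢[] , _) = contradiction refl S≢[]
clique⊆simplex {S = p ∷ []} _
  -- A single vertex lies in each of its simplices, and the empty row below the diagram can always
  -- grow.
  with j , dec , _ ← addable-∃ (rows p) (rows-decreasing p)
    (subst (0 ∈_) (sym (toList-rows p)) (∈-++⁺ʳ (parts p) (here refl))) =
  fullTop p (j , dec) , λ { (here refl) → inj₂ (p , (j , dec) , ≐-refl) , inj₁ refl }
clique⊆simplex {S = p ∷ q ∷ rs} (_ , (p~q ∷ p~rs) ∷ q~rs ∷ rs~)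
  with x , y , st ← Adjacent⇒Step p~q
  with Steps-common-end st p~rs q~rs rs~
... | inj₁ sources
  with i , lt , eq ← removable-∃ (parts p) (Partition.decreasing p) (Step-source-∈ st) =
  fullStar p (i , lt) , λ s∈ → inj₁ (p , (i , lt) , ≐-refl) , member s∈
  where
  member : ∀ {s} → s ∈ p ∷ q ∷ rs → fullStar p (i , lt) s
  member (here refl)         = inj₁ refl
  member (there (here refl)) = Step⇒fullStar (i , lt) eq st
  member (there (there s∈))  = Step⇒fullStar (i , lt) eq (proj₂ (All.lookup sources s∈))
... | inj₂ targets
  with j , dec , eq ← addable-∃ (rows p) (rows-decreasing p) (Step-target-∈ st) =
  fullTop p (j , dec) , λ s∈ → inj₂ (p , (j , dec) , ≐-refl) , member s∈
  where
  member : ∀ {s} → s ∈ p ∷ q ∷ rs → fullTop p (j , dec) s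
  member (here refl)         = inj₁ refl
  member (there (here refl)) = Step⇒fullTop (j , dec) eq st
  member (there (there s∈))  = Step⇒fullTop (j , dec) eq (proj₂ (All.lookup targets s∈))

-- Decidability of membership in full simplices.

Transfer? : (p : Partition n) (c : RemovableCorner p) (a : AddableCorner p) (q : Partition n) →
  Dec (Transfer p c a q)
Transfer? p c a q = ¬? (removableRow p c Fin.≟ addableRow p a)
  ×-dec (parts q ↭? _) ×-dec ¬? (q ≟ₚ p)

-- A corner pairs a row with a proof; irrelevance of that proof reduces the search to rows.
Fin-Σ? : ∀ {m} {B : Fin m → Set} {C : Σ[ i ∈ Fin m ] B i → Set} →
  (∀ i → Dec (B i)) → (∀ {i} (b b′ : B i) → b ≡ b′) → (∀ s → Dec (C s)) → Dec (∃[ s ] C s)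
Fin-Σ? {B = B} {C} B? irr C? =
  map′ (λ (i , b , c) → (i , b) , c) (λ ((i , b) , c) → i , b , c) (Fin.any? at)
  where
  at : ∀ i → Dec (∃[ b ] C (i , b))
  at i with B? i
  ... | no ¬b = no λ (b , _) → ¬b b
  ... | yes b = map′ (b ,_) (λ (b′ , c) → subst (λ b → C (i , b)) (irr b′ b) c) (C? (i , b))

fullStar? : (p : Partition n) (c : RemovableCorner p) (q : Partition n) → Dec (fullStar p c q)
fullStar? p c q = (q ≟ₚ p) ⊎-dec
  Fin-Σ? (λ _ → Linked.linked? _≥?_ _) (Linked.irrelevant ≤-irrelevant) (λ a → Transfer? p c a q)

fullTop? : (p : Partition n) (a : AddableCorner p) (q : Partition n) → Dec (fullTop p a q)
fullTop? p a q = (q ≟ₚ p) ⊎-dec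
  Fin-Σ? (λ _ → _ <? _) ≤-irrelevant (λ c → Transfer? p c a q)

𝓒-∈? : ∀ {U} → 𝓒 n U → ∀ q → Dec (U q)
𝓒-∈? (inj₁ (p , c , to , from)) q = map′ from to (fullStar? p c q)
𝓒-∈? (inj₂ (p , a , to , from)) q = map′ from to (fullTop? p a q)

-- Chains of intersections.

𝓙-point : ∀ {X} → 𝓙 n X → ∃[ p ] X ⊆ 𝓐 p
𝓙-point ([]    , (S≢[] , _) , _)      = contradiction refl S≢[]
𝓙-point (p ∷ _ , _          , to , _) = p , λ XU → to XU (here refl)

-- Some `U` in `Y` must miss a vertex of the clique defining `X`. Strictness is only a negated
-- inclusion, hence the double negation; it is harmless where the goal is a contradiction.
strict-inclusion-point : ∀ {X Y} → 𝓙 n X → 𝓙 n Y → X ⊂ Y →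
  ¬ ¬ (∃[ p ] X ⊆ 𝓐 p × (∃[ U ] Y U × ¬ U p))
strict-inclusion-point (S , _ , to , from) JY (_ , Y⊈X) none = Y⊈X λ {U} YU → from λ {p} p∈S →
  let 𝓒U = proj₁ (proj₂ (𝓙-point JY) YU) in
  𝓒U , decidable-stable (𝓒-∈? 𝓒U p) λ ¬Up → none (p , (λ XV → to XV p∈S) , U , YU , ¬Up)

no-4-chain : ∀ {X₀ X₁ X₂ X₃} → 𝓙 n X₀ → 𝓙 n X₁ → 𝓙 n X₂ → 𝓙 n X₃ →
  X₀ ⊂ X₁ → X₁ ⊂ X₂ → ¬ X₂ ⊂ X₃
no-4-chain (S , clique , to , from) J₁ J₂ J₃ (X₀⊆X₁ , X₁⊈X₀) X₁⊂X₂ X₂⊂X₃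
  with a , X₃⊆a ← 𝓙-point J₃
  with V , V∈ ← clique⊆simplex clique =
  strict-inclusion-point J₂ J₃ X₂⊂X₃ λ (b , X₂⊆b , U , X₃U , ¬Ub) →
  strict-inclusion-point J₁ J₂ X₁⊂X₂ λ (c , X₁⊆c , U′ , X₂U′ , ¬U′c) →
  let X₂⊆X₃ = proj₁ X₂⊂X₃
      X₁⊆X₂ = proj₁ X₁⊂X₂
      X₁V = X₀⊆X₁ (from V∈)
      -- `U` contains `a` but not `b`; `U′` contains `a` and `b` but not `c`.
      a≢b = λ { refl → ¬Ub (proj₂ (X₃⊆a X₃U)) }
      a≢c = λ { refl → ¬U′c (proj₂ (X₃⊆a (X₂⊆X₃ X₂U′))) }
      b≢c = λ { refl → ¬U′c (proj₂ (X₂⊆b X₂U′)) }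
      at : ∀ {W} → _ → 𝓒 _ W × W a × W b × W c
      at = λ X₁W → proj₁ (X₁⊆c X₁W) , proj₂ (X₃⊆a (X₂⊆X₃ (X₁⊆X₂ X₁W))) ,
        proj₂ (X₂⊆b (X₁⊆X₂ X₁W)) , proj₂ (X₁⊆c X₁W)
  -- Rigidity places `V`, and with it the clique `S`, inside any `W` in `X₁`, so `W` already belongs
  -- to `X₀`.
  in X₁⊈X₀ λ X₁W → from λ p∈S →
    let 𝓒V , Va , Vb , Vc = at X₁V
        𝓒W , Wa , Wb , Wc = at X₁W
    in 𝓒W , 𝓒-rigid 𝓒V 𝓒W a≢b a≢c b≢c Va Vb Vc Wa Wb Wc (proj₂ (V∈ p∈S))

-- Sorting simplices of the order complex.

module _ {a ℓ} {A : Set a} {_<ₐ_ : Rel A ℓ} (<ₐ-trans : Transitive _<ₐ_) where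

  -- The given comparisons steer the insertion; once `x` is below the head, transitivity puts it
  -- below the rest.
  insert-chain : ∀ x {ys} → All (λ y → x <ₐ y ⊎ y <ₐ x) ys → AllPairs _<ₐ_ ys →
    ∃[ zs ] zs ↭ x ∷ ys × AllPairs _<ₐ_ zs
  insert-chain x [] [] = x ∷ [] , ↭-refl , [] ∷ []
  insert-chain x (inj₁ x<y ∷ _) (y<ys ∷ chain) =
    _ , ↭-refl , (x<y ∷ All.map (<ₐ-trans x<y) y<ys) ∷ y<ys ∷ chain
  insert-chain x {y ∷ _} (inj₂ y<x ∷ cmp) (y<ys ∷ chain)
    with zs , zs↭ , chain′ ← insert-chain x cmp chain =
    y ∷ zs , ↭-trans (prep y zs↭) (swap y x ↭-refl) ,
    All-resp-↭ (↭-sym zs↭) (y<x ∷ y<ys) ∷ chain′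

  sort-chain : ∀ {xs} → AllPairs (λ x y → x <ₐ y ⊎ y <ₐ x) xs →
    ∃[ ys ] ys ↭ xs × AllPairs _<ₐ_ ys
  sort-chain [] = [] , ↭-refl , []
  sort-chain {x ∷ _} (cmp ∷ pairs)
    with ys , ys↭ , chain ← sort-chain pairs
    with zs , zs↭ , chain′ ← insert-chain x (All-resp-↭ (↭-sym ys↭) cmp) chain =
    zs , ↭-trans zs↭ (prep x ys↭) , chain′

theorem5p15 : (n : ℕ) → n ≥ 1 →
    ((r : ℕ) (X : Fin (suc r) → Pred (PartitionSet n) 0ℓ) →
    (∀ i → 𝓙 n (X i)) →
    (∀ (i : Fin r) → X (inject₁ i) ⊂ X (suc i)) →
    r ≤ 2)
    × DimAtMost (OrderComplex (𝓙-poset n)) 2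
theorem5p15 n _ = chains , dim
  where
  chains : (r : ℕ) (X : Fin (suc r) → Pred (PartitionSet n) 0ℓ) →
    (∀ i → 𝓙 n (X i)) → (∀ (i : Fin r) → X (inject₁ i) ⊂ X (suc i)) → r ≤ 2
  chains 0 X J X⊂ = z≤n
  chains 1 X J X⊂ = s≤s z≤n
  chains 2 X J X⊂ = s≤s (s≤s z≤n)
  chains (suc (suc (suc r))) X J X⊂ = contradiction (X⊂ (suc (suc zero)))
    (no-4-chain (J zero) (J (suc zero)) (J (suc (suc zero))) (J (suc (suc (suc zero))))
      (X⊂ zero) (X⊂ (suc zero)))

  _⊏_ : ∃[ X ] 𝓙 n X → ∃[ X ] 𝓙 n X → Set _
  X ⊏ Y = proj₁ X ⊂ proj₁ Y

  strict : ∀ {X Y : ∃[ X ] 𝓙 n X} →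
    (¬ proj₁ X ≐ proj₁ Y) × (proj₁ X ⊆ proj₁ Y ⊎ proj₁ Y ⊆ proj₁ X) → X ⊏ Y ⊎ Y ⊏ X
  strict (X≠Y , inj₁ X⊆Y) = inj₁ (X⊆Y , λ Y⊆X → X≠Y (X⊆Y , Y⊆X))
  strict (X≠Y , inj₂ Y⊆X) = inj₂ (Y⊆X , λ X⊆Y → X≠Y (X⊆Y , Y⊆X))

  dim : DimAtMost (OrderComplex (𝓙-poset n)) 2
  dim {xs} (_ , unique , comparable)
    with ys , ys↭xs , chain ← sort-chain {_<ₐ_ = _⊏_} ⊂-trans
      (AllPairs.zipWith (λ {X} {Y} → strict {X} {Y}) (unique , comparable)) =
    subst (_≤ 3) (↭-length ys↭xs) (bound chain)
    where
    bound : ∀ {ys} → AllPairs _⊏_ ys → length ys ≤ 3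
    bound {[]}            _ = z≤n
    bound {_ ∷ []}        _ = s≤s z≤n
    bound {_ ∷ _ ∷ []}    _ = s≤s (s≤s z≤n)
    bound {_ ∷ _ ∷ _ ∷ []} _ = s≤s (s≤s (s≤s z≤n))
    bound {(_ , J₀) ∷ (_ , J₁) ∷ (_ , J₂) ∷ (_ , J₃) ∷ _}
      ((X₀⊂X₁ ∷ _) ∷ (X₁⊂X₂ ∷ _) ∷ (X₂⊂X₃ ∷ _) ∷ _) =
      contradiction X₂⊂X₃ (no-4-chain J₀ J₁ J₂ J₃ X₀⊂X₁ X₁⊂X₂)
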